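{- Let $\Omega$ be the set of odd positive integers and let $S:\Omega\to\Omega$ be the Syracuse function, $S(m)=(3m+1)/2^{e}$, where $2^{e}$ is the highest power of $2$ dividing $3m+1$. Then $S$ is wildly increasing-decreasing; that is, for every finite sequence $V=(v_i)_{i=1}^n$ of positive integers there exists $m\in\Omega$ such that $m$ has increasing-decreasing pattern $V$ with respect to $S$.
   Context: For a function $f:\Omega\to\Omega$ on a set $\Omega$ of positive integers, $f^j$ denotes the $j$th iterate of $f$, with $f^0$ the identity. Let $V=(v_i)_{i=1}^n$ be a finite sequence of positive integers. An integer $m\in\Omega$ has increasing-decreasing pattern $V$ with respect to $f$ if, for every odd $i\in\{1,\ldots,n\}$, $$f^{v_1+\cdots+v_{i-1}}(m)<f^{v_1+\cdots+v_{i-1}+1}(m)<\cdots<f^{v_1+\cdots+v_{i-1}+v_i}(m),$$ and, for every even $i\in\{1,\ldots,n\}$, $$f^{v_1+\cdots+v_{i-1}}(m)>f^{v_1+\cdots+v_{i-1}+1}(m)>\cdots>f^{v_1+\cdots+v_{i-1}+v_i}(m),$$ where the empty sum (for $i=1$) is $0$. The function $f$ is wildly increasing-decreasing if for every finite sequence $V$ of positive integers there exists $m\in\Omega$ having increasing-decreasing pattern $V$ with respect to $f$. -}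

module Defs where

open import Data.Fin.Base using (Fin; toℕ)
open import Data.Irrelevant using ([_])
open import Data.List.Base using (List; length; lookup; take)
open import Data.List.Relation.Unary.All using (All)
open import Data.Nat.Base
open import Data.Nat.Divisibility
open import Data.Nat.DivMod using (m/n*n≡m)
open import Data.Nat.ListAction using (sum)
open import Data.Nat.Properties
open import Data.Product.Base using (_×_; ∃)
open import Data.Refinement using (Refinement-syntax; value; _,_)
import Function.Endo.Propositional as Endo
open import Level using (Level)
open import Relation.Binary.PropositionalEquality using (refl; subst)
open import Relation.Nullary.Decidable.Core using (yes; no)
open import Relation.Unary using (Pred)

private
  variable
    ℓ : Level

Even Odd : ℕ → Set
Even n = 2 ∣ n
Odd  n = 2 ∤ n

-- The definitions make sense for any set Ω of natural numbers; positivity of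
-- its members plays no role in them.
module _ {Ω : Pred ℕ ℓ} (f : [ m ∈ ℕ ∣ Ω m ] → [ m ∈ ℕ ∣ Ω m ]) where

  open Endo [ m ∈ ℕ ∣ Ω m ] using () renaming (_^_ to _^∘_)

  orbit : [ m ∈ ℕ ∣ Ω m ] → ℕ → ℕ
  orbit m j = value ((f ^∘ j) m)

  -- `Fin` counts from 0, so the term at index i has 1-based position
  -- suc (toℕ i), and the terms strictly before it sum to `start`.
  HasPattern : List ℕ → [ m ∈ ℕ ∣ Ω m ] → Set
  HasPattern V m = (i : Fin (length V)) →
    let start = sum (take (toℕ i) V) in
    (Odd  (suc (toℕ i)) → ∀ j → j < lookup V i →
       orbit m (start + j) < orbit m (start + suc j)) ×
    (Even (suc (toℕ i)) → ∀ j → j < lookup V i →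
       orbit m (start + j) > orbit m (start + suc j))

  WildlyIncreasingDecreasing : Set ℓ
  WildlyIncreasingDecreasing =
    (V : List ℕ) → All NonZero V → ∃ λ m → HasPattern V m

-- The greatest e ≤ b such that 2 ^ e ∣ n.
ν₂≤ : (b n : ℕ) → ℕ
ν₂≤ zero    n = 0
ν₂≤ (suc b) n with 2 ^ suc b ∣? n
... | yes _ = suc b
... | no  _ = ν₂≤ b n

-- For n > 0, the bound n loses nothing, as 2 ^ e ∣ n forces e < 2 ^ e ≤ n.
ν₂ : ℕ → ℕ
ν₂ n = ν₂≤ n n

2^ν₂≤∣n : ∀ b n → 2 ^ ν₂≤ b n ∣ n
2^ν₂≤∣n zero    n = 1∣ n
2^ν₂≤∣n (suc b) n with 2 ^ suc b ∣? n
... | yes p = p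
... | no  _ = 2^ν₂≤∣n b n

ν₂≤-greatest : ∀ b n e → e ≤ b → 2 ^ e ∣ n → e ≤ ν₂≤ b n
ν₂≤-greatest zero    n e e≤b 2^e∣n = e≤b
ν₂≤-greatest (suc b) n e e≤b 2^e∣n with 2 ^ suc b ∣? n
... | yes _ = e≤b
... | no ¬p = ν₂≤-greatest b n e
  (s≤s⁻¹ (≤∧≢⇒< e≤b λ e≡ → ¬p (subst (λ x → 2 ^ x ∣ n) e≡ 2^e∣n))) 2^e∣n

n<2^n : ∀ n → n < 2 ^ n
n<2^n zero    = z<s
n<2^n (suc n) = +-mono-≤ (m^n>0 2 n) (≤-trans (n<2^n n) (m≤m+n (2 ^ n) 0))

2^ν₂∣n : ∀ n → 2 ^ ν₂ n ∣ n
2^ν₂∣n n = 2^ν₂≤∣n n n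

ν₂-greatest : ∀ n .{{_ : NonZero n}} e → 2 ^ e ∣ n → e ≤ ν₂ n
ν₂-greatest n e 2^e∣n =
  ν₂≤-greatest n n e (≤-trans (<⇒≤ (n<2^n e)) (∣⇒≤ 2^e∣n)) 2^e∣n

oddPart : ℕ → ℕ
oddPart n = _/_ n (2 ^ ν₂ n) {{m^n≢0 2 (ν₂ n)}}

oddPart-odd : ∀ n .{{_ : NonZero n}} → Odd (oddPart n)
oddPart-odd n 2∣q = <-irrefl refl (ν₂-greatest n (suc (ν₂ n)) 2^∣n)
  where
  2^∣n : 2 ^ suc (ν₂ n) ∣ n
  2^∣n = subst (2 ^ suc (ν₂ n) ∣_)
    (m/n*n≡m {{m^n≢0 2 (ν₂ n)}} (2^ν₂∣n n))
    (*-monoˡ-∣ (2 ^ ν₂ n) 2∣q)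

-- Every odd natural number is positive, since 2 ∣ 0.
OddPositive : Set
OddPositive = [ m ∈ ℕ ∣ Odd m ]

syracuse : OddPositive → OddPositive
syracuse (m , _) = oddPart (3 * m + 1) , [ oddPart-odd (3 * m + 1) {{3m+1≢0}} ]
  where
  3m+1≢0 : NonZero (3 * m + 1)
  3m+1≢0 = >-nonZero (m≤n+m 1 (3 * m))

{-# OPTIONS --safe #-}
-- S(1 + 2d) = 2 + 3d is an ascent and S(1 + 4d) = 1 + 3d, for d > 0, a descent,
-- as soon as the value is odd.  Hence any prescribed list of ascents and
-- descents is realized on a whole arithmetic progression whose difference is
-- coprime to 3, by induction on the list: such a progression meets both
-- 2 mod 3 and 1 mod 3 in subprogressions, whose preimages under d ↦ 2 + 3d and
-- d ↦ 1 + 3d provide the progression for the list with one more step in front.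
module Submission where

open import Defs
open import Data.Fin.Base using (Fin; zero; suc; toℕ)
open import Data.Irrelevant using ([_])
open import Data.List.Base using (List; []; _∷_; _++_; length; lookup; replicate; take)
open import Data.Nat.Base
open import Data.Nat.Divisibility
open import Data.Nat.DivMod using (m*n/n≡m; /-congʳ)
open import Data.Nat.ListAction using (sum)
open import Data.Nat.Properties
open import Data.Nat.Tactic.RingSolver using (solve-∀)
open import Data.Product.Base using (_×_; _,_; proj₁; proj₂; Σ; ∃₂)
open import Data.Refinement using (value; _,_)
open import Data.Refinement.Properties using (value-injective)
open import Data.Unit.Base using (⊤)
import Function.Endo.Propositional as Endo
open import Relation.Binary.PropositionalEquality
open import Relation.Nullary using (contradiction; yes; no)

-- Lists the position, counted from p, of the term of V governing each step.
blocks : ℕ → List ℕ → List ℕ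
blocks p []      = []
blocks p (v ∷ V) = replicate v p ++ blocks (suc p) V

module _ {A : Set} (f : A → A) (Step : ℕ → A → Set) where

  open Endo A using (^-homo) renaming (_^_ to _^∘_)

  -- `^-homo` puts the first summand outermost, hence the swap by `+-comm`. With `k = 1` one `f`
  -- moves innermost, where `Follows` applies it.
  ^∘-+ : ∀ k n x → (f ^∘ (k + n)) x ≡ (f ^∘ n) ((f ^∘ k) x)
  ^∘-+ k n x = trans (cong (λ l → (f ^∘ l) x) (+-comm k n))
                     (cong (λ g → g x) (^-homo f n k))

  -- Recursive rather than indexed, so that one more step can be put in front.
  Follows : List ℕ → A → Set
  Follows []       x = ⊤
  Follows (p ∷ ps) x = Step p x × Follows ps (f x)

  follows-replicate : ∀ v {p ps x} → Follows (replicate v p ++ ps) x →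
    (∀ j → j < v → Step p ((f ^∘ j) x)) × Follows ps ((f ^∘ v) x)
  follows-replicate zero    fs = (λ _ ()) , fs
  follows-replicate (suc v) {p} {ps} {x} (s , fs) with follows-replicate v fs
  ... | steps , rest = steps′ , subst (Follows ps) (sym (^∘-+ 1 v x)) rest
    where
    steps′ : ∀ j → j < suc v → Step p ((f ^∘ j) x)
    steps′ zero    _         = s
    steps′ (suc j) (s≤s j<v) = subst (Step p) (sym (^∘-+ 1 j x)) (steps j j<v)

  -- `p` stays general because the induction on `V` continues with `suc p`.
  follows-blocks : ∀ V {p x} → Follows (blocks p V) x →
    (i : Fin (length V)) → ∀ j → j < lookup V i →
    Step (p + toℕ i) ((f ^∘ (sum (take (toℕ i) V) + j)) x)
  follows-blocks (v ∷ V) {p} {x} fs i j j<v with follows-replicate v fs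
  follows-blocks (v ∷ V) {p} {x} fs zero j j<v | steps , _ =
    subst (λ q → Step q ((f ^∘ j) x)) (sym (+-identityʳ p)) (steps j j<v)
  follows-blocks (v ∷ V) {p} {x} fs (suc i) j j<v | _ , rest =
    subst₂ Step (sym (+-suc p (toℕ i)))
      (sym (trans (cong (λ l → (f ^∘ l) x) (+-assoc v s j)) (^∘-+ v (s + j) x)))
      (follows-blocks V rest i j j<v)
    where
    s = sum (take (toℕ i) V)

^-monoʳ-∣ : ∀ n {j k} → j ≤ k → n ^ j ∣ n ^ k
^-monoʳ-∣ n {j} {k} j≤k = subst (n ^ j ∣_)
  (trans (sym (^-distribˡ-+-* n j (k ∸ j))) (cong (n ^_) (m+[n∸m]≡n j≤k)))
  (m∣m*n (n ^ (k ∸ j)))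

odd-1+2* : ∀ d → Odd (1 + 2 * d)
odd-1+2* d 2∣1+2d =
  contradiction (∣1⇒≡1 (∣m+n∣m⇒∣n (subst (2 ∣_) (+-comm 1 (2 * d)) 2∣1+2d) (m∣m*n d))) λ ()

-- A further factor 2 would, after cancelling `2 ^ e`, divide `n`.
ν₂-2^*odd : ∀ e n → Odd n → ν₂ (2 ^ e * n) ≡ e
ν₂-2^*odd e zero        odd = contradiction (2 ∣0) odd
ν₂-2^*odd e n@(suc _) odd = ≤-antisym (≮⇒≥ e≮ν) (ν₂-greatest (2 ^ e * n) e (m∣m*n n))
  where
  instance
    _ = m^n≢0 2 e
    _ = m*n≢0 (2 ^ e) n

  e≮ν : e ≮ ν₂ (2 ^ e * n)
  e≮ν e<ν = odd (*-cancelˡ-∣ (2 ^ e)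
    (subst (_∣ 2 ^ e * n) (*-comm 2 (2 ^ e))
      (∣-trans (^-monoʳ-∣ 2 e<ν) (2^ν₂∣n (2 ^ e * n)))))

oddPart-2^*odd : ∀ e n → Odd n → oddPart (2 ^ e * n) ≡ n
oddPart-2^*odd e n odd = begin
  oddPart (2 ^ e * n) ≡⟨ /-congʳ (cong (2 ^_) (ν₂-2^*odd e n odd)) ⟩
  2 ^ e * n / 2 ^ e   ≡⟨ cong (_/ 2 ^ e) (*-comm (2 ^ e) n) ⟩
  n * 2 ^ e / 2 ^ e   ≡⟨ m*n/n≡m n (2 ^ e) ⟩
  n                   ∎
  where
  open ≡-Reasoning
  instance
    _ = m^n≢0 2 e
    _ = m^n≢0 2 (ν₂ (2 ^ e * n))

-- Oddness proofs are irrelevant, so equal values give equal elements, along which `Follows` can be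
-- transported.
syracuse-≡ : ∀ e {m n} (m-odd : Odd m) (n-odd : Odd n) → 3 * m + 1 ≡ 2 ^ e * n →
             syracuse (m , [ m-odd ]) ≡ (n , [ n-odd ])
syracuse-≡ e {n = n} _ n-odd eq =
  value-injective (trans (cong oddPart eq) (oddPart-2^*odd e n n-odd))

Step : ℕ → OddPositive → Set
Step p m = (Odd p → value m < value (syracuse m)) ×
           (Even p → value m > value (syracuse m))

follows⇒hasPattern : ∀ V {m} → Follows syracuse Step (blocks 1 V) m → HasPattern syracuse V m
follows⇒hasPattern V {m} fs i =
    (λ p-odd  j j<v → subst (λ k → orbit syracuse m (s + j) < orbit syracuse m k)
       (sym (+-suc s j)) (proj₁ (step j j<v) p-odd))
  , (λ p-even j j<v → subst (λ k → orbit syracuse m (s + j) > orbit syracuse m k)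
       (sym (+-suc s j)) (proj₂ (step j j<v) p-even))
  where
  s = sum (take (toℕ i) V)
  step = follows-blocks syracuse Step V fs i

Realizes : List ℕ → ℕ → Set
Realizes ps n = Σ (Odd n) λ odd → Follows syracuse Step ps (n , [ odd ])

-- The oddness contained in `Realizes ps (2 + 3 * d)` makes 2 the exact power of 2 to divide out.
ascent : ∀ {p ps} d → Odd p → Realizes ps (2 + 3 * d) → Realizes (p ∷ ps) (1 + 2 * d)
ascent {ps = ps} d p-odd (odd , fs) = odd-1+2* d
  , ((λ _ → subst (λ x → 1 + 2 * d < value x) (sym S≡) (s≤s (s≤s (m≤n+m (2 * d) d))))
    , λ p-even → contradiction p-even p-odd)
  , subst (Follows syracuse Step ps) (sym S≡) fs
  where
  eq : ∀ d → 3 * (1 + 2 * d) + 1 ≡ 2 * (2 + 3 * d)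
  eq = solve-∀

  S≡ = syracuse-≡ 1 (odd-1+2* d) odd (eq d)

-- Here the exact power is 4; `d = 0` would give the fixed point 1, which does not descend.
descent : ∀ {p ps} d .{{_ : NonZero d}} → Even p →
          Realizes ps (1 + 3 * d) → Realizes (p ∷ ps) (1 + 4 * d)
descent {ps = ps} d p-even (odd , fs) = m-odd
  , ((λ p-odd → contradiction p-even p-odd)
    , λ _ → subst (λ x → value x < 1 + 4 * d) (sym S≡) (s≤s (m<n+m (3 * d) (>-nonZero⁻¹ d))))
  , subst (Follows syracuse Step ps) (sym S≡) fs
  where
  eq : ∀ d → 3 * (1 + 4 * d) + 1 ≡ 4 * (1 + 3 * d)
  eq = solve-∀

  m-odd : Odd (1 + 4 * d)
  m-odd = subst (λ x → Odd (1 + x)) (sym (*-assoc 2 2 d)) (odd-1+2* (2 * d))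

  S≡ = syracuse-≡ 2 m-odd odd (eq d)

-- Writing A = 1 + a and M = 1 + 3q, the term A + M (r + 2A) is ≡ r (mod 3).  From
-- there, strides of 6M (r = 2) and 3M (r = 1) both pull back to 4M, again ≡ 1 (mod 3).
realizing-progression : ∀ ps → ∃₂ λ a q → ∀ t → Realizes ps (1 + a + (1 + 3 * q) * t)
-- The progression 3 + 4t: odd terms, and a difference that is 1 mod 3.
realizing-progression [] = 2 , 1 , λ t → subst Odd (eq t) (odd-1+2* (1 + 2 * t)) , _
  where
  eq : ∀ t → 1 + 2 * (1 + 2 * t) ≡ 3 + 4 * t
  eq = solve-∀
realizing-progression (p ∷ ps) with realizing-progression ps | 2 ∣? p
-- The new difference is 4 (1 + 3q) = 1 + 3 (1 + 4q).
... | a , q , realizes | no p-odd = 2 * c , 1 + 4 * q , λ t →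
  subst (Realizes (p ∷ ps)) (eq₂ c q t)
    (ascent (c + 2 * (1 + 3 * q) * t) p-odd
      (subst (Realizes ps) (eq₁ a q t) (realizes (2 + 2 * (1 + a) + 6 * t))))
  where
  c = 1 + a + q * (2 + 2 * (1 + a))

  eq₁ : ∀ a q t → 1 + a + (1 + 3 * q) * (2 + 2 * (1 + a) + 6 * t) ≡
                  2 + 3 * (1 + a + q * (2 + 2 * (1 + a)) + 2 * (1 + 3 * q) * t)
  eq₁ = solve-∀

  eq₂ : ∀ c q t → 1 + 2 * (c + 2 * (1 + 3 * q) * t) ≡
                  1 + 2 * c + (1 + 3 * (1 + 4 * q)) * t
  eq₂ = solve-∀
... | a , q , realizes | yes p-even = 4 * c , 1 + 4 * q , λ t →
  subst (Realizes (p ∷ ps)) (eq₂ c q t)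
    -- `c` is a successor, so the argument is visibly nonzero.
    (descent (c + (1 + 3 * q) * t) p-even
      (subst (Realizes ps) (eq₁ a q t) (realizes (1 + 2 * (1 + a) + 3 * t))))
  where
  c = 1 + a + q * (1 + 2 * (1 + a))

  eq₁ : ∀ a q t → 1 + a + (1 + 3 * q) * (1 + 2 * (1 + a) + 3 * t) ≡
                  1 + 3 * (1 + a + q * (1 + 2 * (1 + a)) + (1 + 3 * q) * t)
  eq₁ = solve-∀

  eq₂ : ∀ c q t → 1 + 4 * (c + (1 + 3 * q) * t) ≡
                  1 + 4 * c + (1 + 3 * (1 + 4 * q)) * t
  eq₂ = solve-∀

theorem4 : WildlyIncreasingDecreasing syracuse
-- Counting starts at 1 to match the positions in `HasPattern`.
theorem4 V _ with realizing-progression (blocks 1 V)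
-- Any term of the progression would serve.
... | _ , _ , realizes with realizes 0
... | odd , fs = (_ , [ odd ]) , follows⇒hasPattern V fs
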